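{- Let $(u_n)_{n\in\mathbb Z}$ be a 4-chain. Then infinitely many terms $u_n$ are divisible by $3$, and no term $u_n$ is divisible by $2$, by $5$, or by $7$.
   Context: A 4-chain is a bi-infinite sequence of integers $(u_n)_{n\in\mathbb Z}$ satisfying $u_{n-1}u_{n+1}=u_n^3+u_n^{f(n)}+1$ for all $n\in\mathbb Z$, where $f(n)=1$ if $n\equiv 0,3\pmod 4$ and $f(n)=2$ if $n\equiv 1,2\pmod 4$. -}

module Defs where

open import Data.Integer using (ℤ; 1ℤ; _+_; _-_; _*_; _^_; _%ℕ_)
open import Data.List using (List)
open import Data.List.Membership.Propositional using (_∉_)
open import Data.Nat using (ℕ)
open import Data.Product using (∃-syntax; _×_)
open import Level using (Level; _⊔_)
open import Relation.Binary.PropositionalEquality using (_≡_)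
open import Relation.Unary using (Pred)

exponentOfResidue : ℕ → ℕ
exponentOfResidue 1 = 2
exponentOfResidue 2 = 2
exponentOfResidue _ = 1

-- _%ℕ_ is the Euclidean remainder, so n %ℕ 4 lies in {0,1,2,3} for
-- negative n as well.
f : ℤ → ℕ
f n = exponentOfResidue (n %ℕ 4)

FourChain : (ℤ → ℤ) → Set
FourChain u = ∀ (n : ℤ) → u (n - 1ℤ) * u (n + 1ℤ) ≡ u n ^ 3 + u n ^ f n + 1ℤ

-- The positive form of "P is not finite": no finite list exhausts P.
Infinite : ∀ {a p : Level} {A : Set a} → Pred A p → Set (a ⊔ p)
Infinite {A = A} P = ∀ (xs : List A) → ∃[ x ] (x ∉ xs × P x)

{-# OPTIONS --safe #-}
module Submission where

-- Let g(e, t) = t ^ 3 + t ^ e + 1 with e ∈ {1, 2}.  Modulo 2, 5 and 7 neither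
-- polynomial g(e, ·) has a root, and every term of the chain divides some
-- value of one of them.  Modulo 3 the residue 1 is a root of both, so a term
-- ≡ 1 has a neighbour divisible by 3.  Three consecutive terms ≡ 2 centred at
-- a multiple of 4 would give 2 · 2 ≡ g(1, 2) = 11 (mod 3), which is false.
-- Hence every window [4k - 2, 4k + 2] contains a term divisible by 3.

open import Defs
open import Data.Empty using (⊥; ⊥-elim)
open import Data.Fin using (Fin; zero; suc; toℕ; fromℕ<)
open import Data.Fin.Properties using (all?; toℕ-fromℕ<)
open import Data.Integer
  using (ℤ; +_; 0ℤ; 1ℤ; _+_; -_; _-_; _*_; _^_; _/ℕ_; _%ℕ_; ∣_∣)
open import Data.Integer.DivMod using (a≡a%ℕn+[a/ℕn]*n; n%ℕd<d)
open import Data.Integer.Divisibility using (_∣_)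
import Data.Integer.Divisibility.Signed as Signed
open import Data.Integer.Properties using (abs-*)
open import Data.Integer.Tactic.RingSolver using (solve-∀)
open import Data.List.Extrema.Nat using (argmax; f[xs]≤f[argmax])
import Data.List.Relation.Unary.All as All
open import Data.Nat as ℕ using (ℕ; zero; suc; NonZero)
open import Data.Nat.DivMod using (m*n%n≡0)
import Data.Nat.Divisibility as ℕ
open import Data.Nat.Primality using (prime?; euclidsLemma)
import Data.Nat.Properties as ℕ
open import Data.Product using (_×_; _,_; ∃-syntax)
open import Data.Sum using (_⊎_; inj₁; inj₂; [_,_]′)
open import Relation.Binary.PropositionalEquality
  using (_≡_; refl; sym; trans; cong; subst)
open import Relation.Nullary using (¬_; Dec; ¬?)
open import Relation.Nullary.Decidable using (from-yes; from-no)

infix 4 _≡_mod_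

-- Signed divisibility carries an integer quotient, so each congruence law reduces to a ring
-- identity between differences. The unsigned `_∣_` is kept for decidable tests and Euclid's lemma.
_≡_mod_ : ℤ → ℤ → ℕ → Set
x ≡ y mod p = + p Signed.∣ x - y

mod-refl : ∀ {p} x → x ≡ x mod p
mod-refl x = Signed.divides 0ℤ (lemma x)
  where
  lemma : ∀ x → x - x ≡ 0ℤ
  lemma = solve-∀

+-cong-mod : ∀ {p} x y z w → x ≡ y mod p → z ≡ w mod p → x + z ≡ y + w mod p
+-cong-mod {p} x y z w x≡y z≡w =
  subst (+ p Signed.∣_) (lemma x y z w) (Signed.∣m∣n⇒∣m+n x≡y z≡w)
  where
  lemma : ∀ x y z w → (x - y) + (z - w) ≡ (x + z) - (y + w)
  lemma = solve-∀

*-cong-mod : ∀ {p} x y z w → x ≡ y mod p → z ≡ w mod p → x * z ≡ y * w mod p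
*-cong-mod {p} x y z w x≡y z≡w =
  subst (+ p Signed.∣_) (lemma x y z w)
    (Signed.∣m∣n⇒∣m+n (Signed.∣m⇒∣m*n z x≡y) (Signed.∣n⇒∣m*n y z≡w))
  where
  lemma : ∀ x y z w → (x - y) * z + y * (z - w) ≡ x * z - y * w
  lemma = solve-∀

^-cong-mod : ∀ {p} x y k → x ≡ y mod p → x ^ k ≡ y ^ k mod p
^-cong-mod x y zero    x≡y = mod-refl 1ℤ
^-cong-mod x y (suc k) x≡y =
  *-cong-mod x y (x ^ k) (y ^ k) x≡y (^-cong-mod x y k x≡y)

mod-sym : ∀ {p} x y → x ≡ y mod p → y ≡ x mod p
mod-sym {p} x y x≡y = subst (+ p Signed.∣_) (lemma x y) (Signed.∣m⇒∣-m x≡y)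
  where
  lemma : ∀ x y → - (x - y) ≡ y - x
  lemma = solve-∀

mod-trans : ∀ {p} x y z → x ≡ y mod p → y ≡ z mod p → x ≡ z mod p
mod-trans {p} x y z x≡y y≡z =
  subst (+ p Signed.∣_) (lemma x y z) (Signed.∣m∣n⇒∣m+n x≡y y≡z)
  where
  lemma : ∀ x y z → (x - y) + (y - z) ≡ x - z
  lemma = solve-∀

∣-resp-mod : ∀ {p} x y → x ≡ y mod p → + p ∣ x → + p ∣ y
∣-resp-mod {p} x y x≡y p∣x = Signed.∣⇒∣ᵤ
  (subst (+ p Signed.∣_) (lemma x y)
    (Signed.∣m∣n⇒∣m-n (Signed.∣ᵤ⇒∣ {i = x} p∣x) x≡y))
  where
  lemma : ∀ x y → x - (x - y) ≡ y
  lemma = solve-∀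

residue : ∀ p .{{_ : NonZero p}} x → ∃[ r ] x ≡ + toℕ {p} r mod p
residue p x = fromℕ< (n%ℕd<d x p) , Signed.divides (x /ℕ p) x-r≡qp
  where
  lemma : ∀ r s → (r + s) - r ≡ s
  lemma = solve-∀

  x-r≡qp : x - + toℕ (fromℕ< (n%ℕd<d x p)) ≡ (x /ℕ p) * + p
  x-r≡qp rewrite toℕ-fromℕ< (n%ℕd<d x p) =
    trans (cong (_- + (x %ℕ p)) (a≡a%ℕn+[a/ℕn]*n x p)) (lemma (+ (x %ℕ p)) _)

g : ℕ → ℤ → ℤ
g e t = t ^ 3 + t ^ e + 1ℤ

g-cong-mod : ∀ {p} e x y → x ≡ y mod p → g e x ≡ g e y mod p
g-cong-mod e x y x≡y =
  +-cong-mod (x ^ 3 + x ^ e) (y ^ 3 + y ^ e) 1ℤ 1ℤ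
    (+-cong-mod (x ^ 3) (y ^ 3) (x ^ e) (y ^ e)
      (^-cong-mod x y 3 x≡y) (^-cong-mod x y e x≡y))
    (mod-refl 1ℤ)

-- Quantifying over `Fin p` makes this a finite check, which `from-yes` can evaluate for concrete
-- `p` and `e`.
RootFree : ℕ → ℕ → Set
RootFree p e = ∀ (r : Fin p) → ¬ (+ p ∣ g e (+ toℕ r))

rootFree? : ∀ p e → Dec (RootFree p e)
rootFree? p e = all? λ r → ¬? (p ℕ.∣? ∣ g e (+ toℕ r) ∣)

rootFree⇒∤g : ∀ p .{{_ : NonZero p}} e → RootFree p e → ∀ x → ¬ (+ p ∣ g e x)
rootFree⇒∤g p e rootFree x p∣gx =
  let r , x≡r = residue p x
  in rootFree r (∣-resp-mod (g e x) (g e (+ toℕ r))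
       (g-cong-mod e x (+ toℕ r) x≡r) p∣gx)

f≡1⊎f≡2 : ∀ n → f n ≡ 1 ⊎ f n ≡ 2
f≡1⊎f≡2 n = exponent (n %ℕ 4)
  where
  exponent : ∀ r → exponentOfResidue r ≡ 1 ⊎ exponentOfResidue r ≡ 2
  exponent 0                   = inj₁ refl
  exponent 1                   = inj₂ refl
  exponent 2                   = inj₂ refl
  exponent (suc (suc (suc _))) = inj₁ refl

f[4k]≡1 : ∀ k → f (+ (k ℕ.* 4)) ≡ 1
f[4k]≡1 k = cong exponentOfResidue (m*n%n≡0 k 4)

module _ (u : ℤ → ℤ) (chain : FourChain u) where

  -- The term `u n` is the left factor in the chain relation at `n + 1ℤ`, so `p` would divide
  -- `g (f m) (u m)` with `m = n + 1ℤ`. Since `f m` may be 1 or 2, both polynomials must be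
  -- root-free.
  rootFree⇒∤ : ∀ p .{{_ : NonZero p}} → RootFree p 1 → RootFree p 2 →
               ∀ n → ¬ (+ p ∣ u n)
  rootFree⇒∤ p rootFree₁ rootFree₂ n p∣un = p∤g (f≡1⊎f≡2 m)
    where
    m = n + 1ℤ

    lemma : ∀ n → n ≡ (n + 1ℤ) - 1ℤ
    lemma = solve-∀

    p∣g : + p ∣ g (f m) (u m)
    p∣g = subst (+ p ∣_) (chain m)
      (Signed.∣⇒∣ᵤ (Signed.∣m⇒∣m*n (u (m + 1ℤ))
        (Signed.∣ᵤ⇒∣ {k = + p} {i = u (m - 1ℤ)} (subst (λ i → + p ∣ u i) (lemma n) p∣un))))

    p∤g : f m ≡ 1 ⊎ f m ≡ 2 → ⊥
    p∤g (inj₁ fm≡1) = rootFree⇒∤g p 1 rootFree₁ (u m)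
      (subst (λ e → + p ∣ g e (u m)) fm≡1 p∣g)
    p∤g (inj₂ fm≡2) = rootFree⇒∤g p 2 rootFree₂ (u m)
      (subst (λ e → + p ∣ g e (u m)) fm≡2 p∣g)

  -- For either exponent `g e 1ℤ` equals 3, so the prime 3 divides the product of the two
  -- neighbours.
  ≡1⇒3∣neighbour : ∀ n → u n ≡ 1ℤ mod 3 →
                   (+ 3 ∣ u (n - 1ℤ)) ⊎ (+ 3 ∣ u (n + 1ℤ))
  ≡1⇒3∣neighbour n un≡1 =
    euclidsLemma ∣ u (n - 1ℤ) ∣ ∣ u (n + 1ℤ) ∣ (from-yes (prime? 3))
      (subst (3 ℕ.∣_) (abs-* (u (n - 1ℤ)) (u (n + 1ℤ)))
        (subst (+ 3 ∣_) (sym (chain n))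
          (∣-resp-mod (g (f n) 1ℤ) (g (f n) (u n))
            (g-cong-mod (f n) 1ℤ (u n) (mod-sym (u n) 1ℤ un≡1)) 3∣g[1])))
    where
    3∣g[1] : + 3 ∣ g (f n) 1ℤ
    3∣g[1] with f≡1⊎f≡2 n
    ... | inj₁ fn≡1 rewrite fn≡1 = ℕ.∣-refl
    ... | inj₂ fn≡2 rewrite fn≡2 = ℕ.∣-refl

  -- Exponent 1 is essential: `g 2 (+ 2)` is 13, which agrees with 2 · 2 modulo 3 and gives no
  -- contradiction.
  ¬≡2-thrice : ∀ n → f n ≡ 1 → u (n - 1ℤ) ≡ + 2 mod 3 → u n ≡ + 2 mod 3 →
               u (n + 1ℤ) ≡ + 2 mod 3 → ⊥
  ¬≡2-thrice n fn≡1 a≡2 b≡2 c≡2 =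
    -- The 7 is the absolute value of 4 - 11.
    from-no (3 ℕ.∣? 7) (Signed.∣⇒∣ᵤ 4≡11)
    where
    ac≡11 : u (n - 1ℤ) * u (n + 1ℤ) ≡ + 11 mod 3
    ac≡11 = subst (λ x → x ≡ + 11 mod 3)
      (trans (cong (λ e → g e (u n)) (sym fn≡1)) (sym (chain n)))
      (g-cong-mod 1 (u n) (+ 2) b≡2)

    4≡11 : + 4 ≡ + 11 mod 3
    4≡11 = mod-trans (+ 4) (u (n - 1ℤ) * u (n + 1ℤ)) (+ 11)
      (mod-sym (u (n - 1ℤ) * u (n + 1ℤ)) (+ 4)
        (*-cong-mod (u (n - 1ℤ)) (+ 2) (u (n + 1ℤ)) (+ 2) a≡2 c≡2))
      ac≡11

  ∃3∣-beyond : ∀ k → ∃[ j ] (k ℕ.< j × (+ 3 ∣ u (+ j)))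
  ∃3∣-beyond k = search (residue 3 (u (n - 1ℤ))) (residue 3 (u n))
                        (residue 3 (u (n + 1ℤ)))
    where
    -- A multiple of 4 gives exponent 1 at the centre. With `suc k`, even the leftmost index of the
    -- window, `n - 2 = 4k + 2`, exceeds `k`.
    n = + (suc k ℕ.* 4)

    Occurrence : Set
    Occurrence = ∃[ j ] (k ℕ.< j × (+ 3 ∣ u (+ j)))

    -- Here `d + 1` is the offset from `4k` that computation exposes as successors in the index: 2,
    -- 3 or 4 in the uses below.
    hit : ∀ d {i} → suc (d ℕ.+ k ℕ.* 4) ℕ.≤ i → + 3 ∣ u (+ i) → Occurrence
    hit d {i} d+4k<i 3∣ui = i , ℕ.≤-trans (ℕ.s≤s k≤d+4k) d+4k<i , 3∣ui
      where
      k≤d+4k : k ℕ.≤ d ℕ.+ k ℕ.* 4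
      k≤d+4k = ℕ.≤-trans (ℕ.m≤m*n k 4) (ℕ.m≤n+m (k ℕ.* 4) d)

    around : ∀ m → u m ≡ 1ℤ mod 3 →
             (+ 3 ∣ u (m - 1ℤ) → Occurrence) →
             (+ 3 ∣ u (m + 1ℤ) → Occurrence) →
             Occurrence
    around m um≡1 left right = [ left , right ]′ (≡1⇒3∣neighbour m um≡1)

    ≡0⇒3∣ : ∀ x → x ≡ 0ℤ mod 3 → + 3 ∣ x
    ≡0⇒3∣ x x≡0 = ∣-resp-mod 0ℤ x (mod-sym x 0ℤ x≡0) (ℕ._∣0 3)

    search : ∃[ r ] u (n - 1ℤ) ≡ + toℕ {3} r mod 3 →
             ∃[ r ] u n ≡ + toℕ {3} r mod 3 →
             ∃[ r ] u (n + 1ℤ) ≡ + toℕ {3} r mod 3 →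
             Occurrence
    search (zero , a≡0) _ _ = hit 2 ℕ.≤-refl (≡0⇒3∣ (u (n - 1ℤ)) a≡0)
    search _ (zero , b≡0) _ = hit 3 ℕ.≤-refl (≡0⇒3∣ (u n) b≡0)
    -- Adding `1ℤ` puts the 1 on the right of a natural-number sum, where it does not reduce to a
    -- successor; `m≤m+n` absorbs it.
    search _ _ (zero , c≡0) = hit 3 (ℕ.m≤m+n _ 1) (≡0⇒3∣ (u (n + 1ℤ)) c≡0)
    search (suc zero , a≡1) _ _ = around (n - 1ℤ) a≡1
      (hit 1 ℕ.≤-refl) (hit 2 (ℕ.m≤m+n _ 1))
    search _ (suc zero , b≡1) _ = around n b≡1
      (hit 2 ℕ.≤-refl) (hit 3 (ℕ.m≤m+n _ 1))
    search _ _ (suc zero , c≡1) = around (n + 1ℤ) c≡1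
      (hit 2 (ℕ.m≤m+n _ 1))
      (hit 3 (ℕ.≤-trans (ℕ.m≤m+n _ 1) (ℕ.m≤m+n _ 1)))
    search (suc (suc zero) , a≡2) (suc (suc zero) , b≡2) (suc (suc zero) , c≡2) =
      ⊥-elim (¬≡2-thrice n (f[4k]≡1 (suc k)) a≡2 b≡2 c≡2)

theorem7 : (u : ℤ → ℤ) → FourChain u →
    Infinite (λ (n : ℤ) → + 3 ∣ u n)
    × (∀ (n : ℤ) → ¬ (+ 2 ∣ u n) × ¬ (+ 5 ∣ u n) × ¬ (+ 7 ∣ u n))
theorem7 u chain = infinite , λ n →
    rootFree⇒∤ u chain 2 (from-yes (rootFree? 2 1)) (from-yes (rootFree? 2 2)) n
  , rootFree⇒∤ u chain 5 (from-yes (rootFree? 5 1)) (from-yes (rootFree? 5 2)) n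
  , rootFree⇒∤ u chain 7 (from-yes (rootFree? 7 1)) (from-yes (rootFree? 7 2)) n
  where
  infinite : Infinite (λ n → + 3 ∣ u n)
  infinite xs =
    -- Choose `j` beyond every absolute value in `xs`; membership of `+ j` would bound `j` by that
    -- maximum. The default `0ℤ` covers the empty list.
    let j , b<j , 3∣uj = ∃3∣-beyond u chain ∣ argmax ∣_∣ 0ℤ xs ∣
    in + j
     , (λ j∈xs → ℕ.<⇒≱ b<j (All.lookup (f[xs]≤f[argmax] {f = ∣_∣} 0ℤ xs) j∈xs))
     , 3∣uj
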